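{- Let $\mathbb{F}_q$ be a finite field with $q$ elements, let $A\subset\mathbb{F}_q$ with $|A|>\sqrt q$, and let $E=A\times A\times A\times A\subset\mathbb{F}_q^4$. Then $$vol(E)=\mathbb{F}_q.$$
   Context: For $x^1,\dots,x^4\in\mathbb{F}_q^4$, $vol(x^1,x^2,x^3,x^4)$ is the determinant of the $4\times4$ matrix with rows $x^1,x^2,x^3,x^4$, and $vol(E)=\{vol(x^1,x^2,x^3,x^4): x^j\in E\}\subset\mathbb{F}_q$. -}

module Defs where

open import Level using (Level; _⊔_)
open import Algebra.Apartness using (HeytingField; HeytingCommutativeRing)
open import Algebra.Bundles using (CommutativeRing)
open import Data.Fin.Base using (Fin; zero; suc; toℕ)
open import Data.Nat.Base using (ℕ; zero; suc)
open import Data.Product.Base using (Σ; Σ-syntax; _×_; proj₁)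
open import Data.Vec.Functional using (Vector; []; _∷_; removeAt)
open import Function.Bundles using (Inverse)
open import Relation.Binary.Bundles using (Setoid)
import Relation.Binary.Construct.On as On
open import Relation.Binary.PropositionalEquality.Properties using () renaming (setoid to ≡-setoid)
open import Relation.Unary using (Pred; _∈_)

private
  variable
    c ℓ ℓ₁ ℓ₂ p : Level

HasCardinality : Setoid c ℓ → ℕ → Set (c ⊔ ℓ)
HasCardinality S n = Inverse (≡-setoid (Fin n)) S

SubSetoid : (S : Setoid c ℓ) → Pred (Setoid.Carrier S) p → Setoid (c ⊔ p) ℓ
SubSetoid S P = On.setoid {B = Σ (Setoid.Carrier S) P} S proj₁

-- A Heyting field whose setoid is finite is a finite field in the classical
-- sense: _≈_ and invertibility are then decidable, so x # y iff x ≉ y, every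
-- x ≉ 0# is invertible, and 0# ≉ 1# because otherwise 0# would be invertible
-- and hence apart from itself.
module _ (F : HeytingField c ℓ₁ ℓ₂) where

  open HeytingField F using (Carrier; heytingCommutativeRing)
  open HeytingCommutativeRing heytingCommutativeRing using (commutativeRing)
  open CommutativeRing commutativeRing
    using (_≈_; _*_; -_; 1#; setoid; +-rawMonoid)
  open import Algebra.Definitions.RawMonoid +-rawMonoid using (sum)

  fieldSetoid : Setoid c ℓ₁
  fieldSetoid = setoid

  sign : ℕ → Carrier
  sign zero    = 1#
  sign (suc n) = - sign n

  -- Laplace expansion along the first row.
  det : ∀ {n} → Vector (Vector Carrier n) n → Carrier
  det {zero}  M = 1#
  det {suc n} M =
    sum λ j → sign (toℕ j) * (M zero j * det (λ i → removeAt (M (suc i)) j))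

  vol : (x¹ x² x³ x⁴ : Vector Carrier 4) → Carrier
  vol x¹ x² x³ x⁴ = det (x¹ ∷ x² ∷ x³ ∷ x⁴ ∷ [])

  volSet : Pred (Vector Carrier 4) p → Pred Carrier (c ⊔ ℓ₁ ⊔ p)
  volSet E t =
    Σ[ x¹ ∈ Vector Carrier 4 ] Σ[ x² ∈ Vector Carrier 4 ]
    Σ[ x³ ∈ Vector Carrier 4 ] Σ[ x⁴ ∈ Vector Carrier 4 ]
      (x¹ ∈ E × x² ∈ E × x³ ∈ E × x⁴ ∈ E × t ≈ vol x¹ x² x³ x⁴)

  A×A×A×A : Pred Carrier p → Pred (Vector Carrier 4) p
  A×A×A×A A x = ∀ i → x i ∈ A

{-# OPTIONS --safe #-}
-- Let d = y − z with y , z ∈ A and let a ∈ A be nonzero. A matrix with rows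
-- (a,z,p₀,z), (a,z,p₁,y), (a,y,u₀,v₀), (a,y,u₁,v₁) has determinant
-- a d (d (u₁ − u₀) − (p₁ − p₀) (v₁ − v₀)). Since |A|² > q, the map (r , s) ↦ r + x s
-- on A × A is never injective, so every slope x equals (p₁ − p₀) / d for suitable
-- p₀ , p₁ , y , z ∈ A with d ≠ 0, and the determinant becomes
-- a d² ((u₁ − u₀) − x (v₁ − v₀)). It remains to choose x such that S − S is the
-- whole field for S = A + x A. Two distinct points of A × A have the same image for
-- at most one x, so for some x fewer than 2|A|⁴/q ordered pairs of points (equal ones
-- included) have the same image. For such an x, Cauchy–Schwarz shows that S meets each
-- of its translates.
module Submission where

open import Defs
open import Algebra.Apartness using (HeytingField; HeytingCommutativeRing)
open import Algebra.Bundles using (CommutativeRing; RawRing)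
import Algebra.Solver.Ring
open import Algebra.Solver.Ring.AlmostCommutativeRing
  using (fromCommutativeRing; _-Raw-AlmostCommutative⟶_; Induced-equivalence)
open import Data.Fin.Base using (Fin; zero; suc; toℕ; remQuot; combine)
open import Data.Fin.Properties
  using (_≟_; any?; ¬∀⟶∃¬; suc-injective; 0≢1+n; pigeonhole; nonZeroIndex; combine-remQuot; <⇒≢)
open import Data.Maybe.Base using (map)
open import Data.Nat.Base as ℕ using (ℕ; zero; suc; NonZero; >-nonZero; z≤n; s≤s)
import Data.Nat.Properties as ℕ
open import Data.Nat.Solver using (module +-*-Solver)
open import Data.Product.Base using (∃; ∃₂; _×_; _,_; proj₁; proj₂; swap)
open import Data.Sum.Base using (inj₁; inj₂)
open import Data.Unit.Base using (tt)
open import Data.Vec.Functional using (Vector; []; _∷_; removeAt; foldr)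
open import Function.Base using (_∘_; const)
open import Function.Bundles using (Inverse)
open import Relation.Binary.Definitions using (Decidable; WeaklyDecidable; _Respects_)
open import Relation.Binary.PropositionalEquality as ≡ using (_≡_; _≢_)
import Relation.Binary.Reasoning.Setoid as ≈-Reasoning
open import Relation.Nullary using (yes; no; does; ¬_; contradiction)
open import Relation.Nullary.Decidable using (map′; dec⇒maybe)
open import Relation.Unary using (Pred; U; _≐_)

-- Sums over finite index sets, with `δ` as the indicator of equality.

module Counting where

  open import Algebra.Properties.Semiring.Sum ℕ.+-*-semiring
    using (sum; sum-syntax; sum-cong-≗; sum-replicate-zero; ∑-comm; ∑-distrib-+;
           *-distribˡ-sum; *-distribʳ-sum)
  open import Data.Bool.Base using (if_then_else_)
  open import Data.Nat.Base using (_+_; _*_; _≤_; _<_)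
  open import Relation.Binary.PropositionalEquality
    using (refl; sym; trans; cong; cong₂; subst; subst₂; module ≡-Reasoning)
  open +-*-Solver using (solve; _:=_; _:+_; _:*_; con)

  private variable
    m n q : ℕ

  δ : Fin n → Fin n → ℕ
  δ i j = if does (i ≟ j) then 1 else 0

  δ-≡ : {i j : Fin n} → i ≡ j → δ i j ≡ 1
  δ-≡ {i = i} {j} i≡j with i ≟ j
  ... | yes _  = refl
  ... | no i≢j = contradiction i≡j i≢j

  δ-≢ : {i j : Fin n} → i ≢ j → δ i j ≡ 0
  δ-≢ {i = i} {j} i≢j with i ≟ j
  ... | yes i≡j = contradiction i≡j i≢j
  ... | no _    = refl

  δ-≤1 : (i j : Fin n) → δ i j ≤ 1
  δ-≤1 i j with i ≟ j
  ... | yes _ = s≤s z≤n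
  ... | no _  = z≤n

  sum-const : ∀ n x → ∑[ i < n ] x ≡ n * x
  sum-const zero    x = refl
  sum-const (suc n) x = cong (x +_) (sum-const n x)

  sum-mono-≤ : {f g : Vector ℕ n} → (∀ i → f i ≤ g i) → sum f ≤ sum g
  sum-mono-≤ {zero}  f≤g = z≤n
  sum-mono-≤ {suc n} f≤g = ℕ.+-mono-≤ (f≤g zero) (sum-mono-≤ (f≤g ∘ suc))

  sum-zero : {f : Vector ℕ n} → (∀ i → f i ≡ 0) → sum f ≡ 0
  sum-zero {n} f≡0 = trans (sum-cong-≗ f≡0) (sum-replicate-zero n)

  sum-δʳ : (i : Fin n) (f : Vector ℕ n) → ∑[ j < n ] (δ i j * f j) ≡ f i
  sum-δʳ {suc n} zero f = trans
    (cong₂ _+_ (ℕ.*-identityˡ (f zero)) (sum-zero {n} λ _ → refl)) (ℕ.+-identityʳ (f zero))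
  sum-δʳ {suc n} (suc i) f = trans (sum-cong-≗ λ j → cong (_* f (suc j)) (δ-suc j)) (sum-δʳ i (f ∘ suc))
    where
    δ-suc : ∀ j → δ (suc i) (suc j) ≡ δ i j
    δ-suc j with i ≟ j
    ... | yes _ = refl
    ... | no _  = refl

  -- After the first index at which `f` and `g` agree, uniqueness makes every later term zero. This
  -- bounds the number of slopes for which two given points collide.
  sum-δ≤1 : (f g : Fin m → Fin n) → (∀ i j → f i ≡ g i → f j ≡ g j → i ≡ j) →
            ∑[ i < m ] δ (f i) (g i) ≤ 1
  sum-δ≤1 {zero}  f g unique = z≤n
  sum-δ≤1 {suc m} f g unique with f zero ≟ g zero
  ... | no _      = sum-δ≤1 (f ∘ suc) (g ∘ suc) λ i j p q → suc-injective (unique (suc i) (suc j) p q)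
  ... | yes f₀≡g₀ = s≤s (ℕ.≤-reflexive (sum-zero {m} λ i → δ-≢ λ p → 0≢1+n (unique zero (suc i) f₀≡g₀ p)))

  -- If all values were at least `B`, the sum would be at least `n * B`; decidability of `B ≤ f i`
  -- turns this refutation into an actual index.
  average : ∀ B (f : Vector ℕ n) → sum f < n * B → ∃ λ i → f i < B
  average {n} B f Σf<nB with ¬∀⟶∃¬ n (λ i → B ≤ f i) (λ i → B ℕ.≤? f i)
    (λ B≤f → ℕ.<⇒≱ Σf<nB (subst (_≤ sum f) (sum-const n B) (sum-mono-≤ B≤f)))
  ... | i , B≰fi = i , ℕ.≰⇒> B≰fi

  -- Cauchy-Schwarz in the natural numbers, without subtraction.

  x≤y⇒2xy≤x²+y² : ∀ {x y} → x ≤ y → 2 * (x * y) ≤ x * x + y * y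
  x≤y⇒2xy≤x²+y² {x} {y} x≤y with d , refl ← ℕ.m≤n⇒∃[o]m+o≡n x≤y = subst (2 * (x * y) ≤_)
    (solve 2 (λ x d → con 2 :* (x :* (x :+ d)) :+ d :* d := x :* x :+ (x :+ d) :* (x :+ d)) refl x d)
    (ℕ.m≤m+n (2 * (x * (x + d))) (d * d))

  2xy≤x²+y² : ∀ x y → 2 * (x * y) ≤ x * x + y * y
  2xy≤x²+y² x y with ℕ.≤-total x y
  ... | inj₁ x≤y = x≤y⇒2xy≤x²+y² x≤y
  ... | inj₂ y≤x = subst₂ _≤_ (cong (2 *_) (ℕ.*-comm y x)) (ℕ.+-comm (y * y) (x * x)) (x≤y⇒2xy≤x²+y² y≤x)

  2x∑≤ : ∀ x (f : Vector ℕ n) → 2 * (x * sum f) ≤ n * (x * x) + ∑[ i < n ] (f i * f i)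
  2x∑≤ {n} x f = begin
    2 * (x * sum f)
      ≡⟨ trans (cong (2 *_) (*-distribˡ-sum x f)) (*-distribˡ-sum 2 (λ i → x * f i)) ⟩
    ∑[ i < n ] (2 * (x * f i))
      ≤⟨ sum-mono-≤ (λ i → 2xy≤x²+y² x (f i)) ⟩
    ∑[ i < n ] (x * x + f i * f i)
      ≡⟨ ∑-distrib-+ {n} (λ _ → x * x) _ ⟩
    ∑[ i < n ] (x * x) + ∑[ i < n ] (f i * f i)
      ≡⟨ cong (_+ ∑[ i < n ] (f i * f i)) (sum-const n (x * x)) ⟩
    n * (x * x) + ∑[ i < n ] (f i * f i)
      ∎
    where open ℕ.≤-Reasoning

  -- Induction on the length: in (x + s)² the cross term 2xs is bounded by `2x∑≤` and s² by the
  -- induction hypothesis; the bounds add up exactly to the right-hand side.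
  cauchy-schwarz : (f : Vector ℕ n) → sum f * sum f ≤ n * ∑[ i < n ] (f i * f i)
  cauchy-schwarz {zero}  f = z≤n
  cauchy-schwarz {suc n} f = begin
    (x + s) * (x + s)                        ≡⟨ solve 2 (λ x s → (x :+ s) :* (x :+ s) :=
                                                  x :* x :+ con 2 :* (x :* s) :+ s :* s) refl x s ⟩
    x * x + 2 * (x * s) + s * s              ≤⟨ ℕ.+-mono-≤ (ℕ.+-monoʳ-≤ (x * x) (2x∑≤ x (f ∘ suc)))
                                                  (cauchy-schwarz (f ∘ suc)) ⟩
    x * x + (n * (x * x) + t) + n * t        ≡⟨ solve 3 (λ n x² t → x² :+ (n :* x² :+ t) :+ n :* t :=
                                                  (con 1 :+ n) :* (x² :+ t)) refl n (x * x) t ⟩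
    suc n * (x * x + t)                      ∎
    where
    open ℕ.≤-Reasoning
    x = f zero
    s = sum (f ∘ suc)
    t = ∑[ i < n ] (f (suc i) * f (suc i))

  -- Fibres and coincidences of maps into a finite set.

  fibre : (Fin m → Fin n) → Vector ℕ n
  fibre {m} f x = ∑[ i < m ] δ (f i) x

  -- For equal arguments this is the sum of the squared fibre sizes, so the diagonal pairs are
  -- counted as well.
  coincidences : (f g : Fin m → Fin n) → ℕ
  coincidences {m} f g = ∑[ i < m ] fibre f (g i)

  sum-fibre : (f : Fin m → Fin n) → sum (fibre f) ≡ m
  sum-fibre {m} {n} f = begin
    ∑[ x < n ] ∑[ i < m ] δ (f i) x        ≡⟨ ∑-comm {n} {m} _ ⟩
    ∑[ i < m ] ∑[ x < n ] δ (f i) x        ≡⟨ sum-cong-≗ (λ i → sum-cong-≗ λ x → ℕ.*-identityʳ (δ (f i) x)) ⟨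
    ∑[ i < m ] ∑[ x < n ] (δ (f i) x * 1)  ≡⟨ sum-cong-≗ (λ i → sum-δʳ (f i) (const 1)) ⟩
    ∑[ i < m ] 1                           ≡⟨ sum-const m 1 ⟩
    m * 1                                  ≡⟨ ℕ.*-identityʳ m ⟩
    m                                      ∎
    where open ≡-Reasoning

  -- Expanding only the factor `fibre f x` and exchanging the sums leaves, for each `i`, the fibre
  -- of `g` over `f i`.
  sum-fibre-* : (f g : Fin m → Fin n) → ∑[ x < n ] (fibre f x * fibre g x) ≡ coincidences g f
  sum-fibre-* {m} {n} f g = begin
    ∑[ x < n ] (fibre f x * fibre g x)
      ≡⟨ sum-cong-≗ (λ x → *-distribʳ-sum (fibre g x) (λ i → δ (f i) x)) ⟩
    ∑[ x < n ] ∑[ i < m ] (δ (f i) x * fibre g x)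
      ≡⟨ ∑-comm {n} {m} _ ⟩
    ∑[ i < m ] ∑[ x < n ] (δ (f i) x * fibre g x)
      ≡⟨ sum-cong-≗ (λ i → sum-δʳ (f i) (fibre g)) ⟩
    ∑[ i < m ] fibre g (f i)
      ∎
    where open ≡-Reasoning

  coincidences-disjoint : (f g : Fin m → Fin n) → (∀ i j → f i ≢ g j) → coincidences f g ≡ 0
  coincidences-disjoint f g f≢g = sum-zero λ j → sum-zero λ i → δ-≢ (f≢g i j)

  coincidences-∘ : (τ : Fin n → Fin n) → (∀ {x y} → τ x ≡ τ y → x ≡ y) →
                   (f g : Fin m → Fin n) → coincidences (τ ∘ f) (τ ∘ g) ≡ coincidences f g
  coincidences-∘ τ τ-injective f g = sum-cong-≗ λ j → sum-cong-≗ λ i → δ-τ (f i) (g j)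
    where
    δ-τ : ∀ x y → δ (τ x) (τ y) ≡ δ x y
    δ-τ x y with x ≟ y
    ... | yes x≡y = δ-≡ (cong τ x≡y)
    ... | no x≢y  = δ-≢ (x≢y ∘ τ-injective)

  -- Cauchy–Schwarz for the sum of the fibre sizes of f and g.
  disjoint⇒many-collisions : (f g : Fin m → Fin n) → (∀ i j → f i ≢ g j) →
    (m + m) * (m + m) ≤ n * (coincidences f f + coincidences g g)
  disjoint⇒many-collisions {m} {n} f g f≢g = begin
    (m + m) * (m + m)                          ≡⟨ cong₂ _*_ sum-h sum-h ⟨
    sum h * sum h                              ≤⟨ cauchy-schwarz h ⟩
    n * ∑[ x < n ] (h x * h x)                 ≡⟨ cong (n *_) sum-h² ⟩
    n * (coincidences f f + coincidences g g) ∎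
    where
    open ℕ.≤-Reasoning
    h : Vector ℕ n
    h x = fibre f x + fibre g x
    sum-h : sum h ≡ m + m
    sum-h = trans (∑-distrib-+ (fibre f) (fibre g)) (cong₂ _+_ (sum-fibre f) (sum-fibre g))
    f*g = λ x → fibre f x * fibre g x
    f² = λ x → fibre f x * fibre f x
    g² = λ x → fibre g x * fibre g x
    sum-f*g : sum f*g ≡ 0
    sum-f*g = trans (sum-fibre-* f g) (coincidences-disjoint g f λ i j → f≢g j i ∘ sym)
    sum-h² : ∑[ x < n ] (h x * h x) ≡ coincidences f f + coincidences g g
    sum-h² = begin-equality
      ∑[ x < n ] (h x * h x)
        ≡⟨ sum-cong-≗ (λ x → solve 2 (λ a b →
             (a :+ b) :* (a :+ b) := (a :* a :+ b :* b) :+ (a :* b :+ a :* b))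
             refl (fibre f x) (fibre g x)) ⟩
      ∑[ x < n ] ((f² x + g² x) + (f*g x + f*g x))
        ≡⟨ ∑-distrib-+ (λ x → f² x + g² x) (λ x → f*g x + f*g x) ⟩
      ∑[ x < n ] (f² x + g² x) + ∑[ x < n ] (f*g x + f*g x)
        ≡⟨ cong₂ _+_ (∑-distrib-+ f² g²) (∑-distrib-+ f*g f*g) ⟩
      (sum f² + sum g²) + (sum f*g + sum f*g)
        ≡⟨ cong₂ _+_ (cong₂ _+_ (sum-fibre-* f f) (sum-fibre-* g g)) (cong₂ _+_ sum-f*g sum-f*g) ⟩
      (coincidences f f + coincidences g g) + 0
        ≡⟨ ℕ.+-identityʳ _ ⟩
      coincidences f f + coincidences g g ∎

  -- Double counting: two distinct indices collide for at most one `ξ`, equal ones for all `q` of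
  -- them. The total is thus at most m(m + q) < 2m², and some `ξ` lies below the average. The factor
  -- `q` in the conclusion replaces a division.
  few-collisions : (f : Fin q → Fin m → Fin n) → .{{NonZero q}} → q < m →
    (∀ {ξ η i j} → i ≢ j → f ξ i ≡ f ξ j → f η i ≡ f η j → ξ ≡ η) →
    ∃ λ ξ → q * coincidences (f ξ) (f ξ) < m * (m + m)
  few-collisions {q} {m} f q<m separates = average (m * (m + m)) _ (begin-strict
    ∑[ ξ < q ] (q * coincidences (f ξ) (f ξ))  ≡⟨ *-distribˡ-sum q (λ ξ → coincidences (f ξ) (f ξ)) ⟨
    q * ∑[ ξ < q ] coincidences (f ξ) (f ξ)    ≤⟨ ℕ.*-monoʳ-≤ q total ⟩
    q * (m * (m + q))                          <⟨ ℕ.*-monoʳ-< q (ℕ.*-monoʳ-< m (ℕ.+-monoʳ-< m q<m)) ⟩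
    q * (m * (m + m))                          ∎)
    where
    open ℕ.≤-Reasoning
    instance
      m≢0 : NonZero m
      m≢0 = >-nonZero (ℕ.≤-trans (s≤s z≤n) q<m)
    -- On the diagonal 1 + q is allowed instead of q, so that one formula covers both cases and each
    -- row sums to exactly `m + q`.
    pair : ∀ i j → ∑[ ξ < q ] δ (f ξ i) (f ξ j) ≤ 1 + δ j i * q
    pair i j with j ≟ i
    ... | no j≢i = sum-δ≤1 (λ ξ → f ξ i) (λ ξ → f ξ j) (λ ξ η → separates (j≢i ∘ sym))
    ... | yes _  = begin
      ∑[ ξ < q ] δ (f ξ i) (f ξ j)  ≤⟨ sum-mono-≤ (λ ξ → δ-≤1 (f ξ i) (f ξ j)) ⟩
      ∑[ ξ < q ] 1                  ≡⟨ sum-const q 1 ⟩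
      q * 1                         ≡⟨ ℕ.*-comm q 1 ⟩
      1 * q                         ≤⟨ ℕ.n≤1+n (1 * q) ⟩
      1 + 1 * q                     ∎
    total : ∑[ ξ < q ] coincidences (f ξ) (f ξ) ≤ m * (m + q)
    total = begin
      ∑[ ξ < q ] ∑[ j < m ] ∑[ i < m ] δ (f ξ i) (f ξ j)
        ≡⟨ ∑-comm {q} {m} _ ⟩
      ∑[ j < m ] ∑[ ξ < q ] ∑[ i < m ] δ (f ξ i) (f ξ j)
        ≡⟨ sum-cong-≗ {m} (λ j → ∑-comm {q} {m} _) ⟩
      ∑[ j < m ] ∑[ i < m ] ∑[ ξ < q ] δ (f ξ i) (f ξ j)
        ≤⟨ sum-mono-≤ (λ j → sum-mono-≤ λ i → pair i j) ⟩
      ∑[ j < m ] ∑[ i < m ] (1 + δ j i * q)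
        ≡⟨ sum-cong-≗ {m} (λ j → ∑-distrib-+ {m} (const 1) (λ i → δ j i * q)) ⟩
      ∑[ j < m ] (∑[ i < m ] 1 + ∑[ i < m ] (δ j i * q))
        ≡⟨ sum-cong-≗ {m} (λ j →
             cong₂ _+_ (trans (sum-const m 1) (ℕ.*-identityʳ m)) (sum-δʳ j (const q))) ⟩
      ∑[ j < m ] (m + q)
        ≡⟨ sum-const m (m + q) ⟩
      m * (m + q)
        ∎

  -- Let C be the number of collisions of `f ξ`; an injective `τ` preserves it. If the images of
  -- `f ξ` and `τ ∘ f ξ` were disjoint, Cauchy-Schwarz would give (2m)² ≤ 2qC, whereas the choice of
  -- `ξ` gives 2qC < (2m)².
  meets-translates : (f : Fin q → Fin m → Fin q) → .{{NonZero q}} → q < m →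
    (∀ {ξ η i j} → i ≢ j → f ξ i ≡ f ξ j → f η i ≡ f η j → ξ ≡ η) →
    ∃ λ ξ → ∀ (τ : Fin q → Fin q) → (∀ {x y} → τ x ≡ τ y → x ≡ y) → ∃₂ λ i j → f ξ i ≡ τ (f ξ j)
  meets-translates {q} {m} f q<m separates with few-collisions f q<m separates
  ... | ξ , few = ξ , meets
    where
    open ℕ.≤-Reasoning
    C = coincidences (f ξ) (f ξ)
    meets : ∀ (τ : Fin q → Fin q) → (∀ {x y} → τ x ≡ τ y → x ≡ y) → ∃₂ λ i j → f ξ i ≡ τ (f ξ j)
    meets τ τ-injective with any? (λ i → any? λ j → f ξ i ≟ τ (f ξ j))
    ... | yes found = found
    ... | no  none  = contradiction (begin-strict
      (m + m) * (m + m)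
        ≤⟨ disjoint⇒many-collisions (f ξ) (τ ∘ f ξ) (λ i j p → none (i , j , p)) ⟩
      q * (C + coincidences (τ ∘ f ξ) (τ ∘ f ξ))
        ≡⟨ cong (λ c → q * (C + c)) (coincidences-∘ τ τ-injective (f ξ) (f ξ)) ⟩
      q * (C + C)
        ≡⟨ ℕ.*-distribˡ-+ q C C ⟩
      q * C + q * C
        <⟨ ℕ.+-mono-< few few ⟩
      m * (m + m) + m * (m + m)
        ≡⟨ ℕ.*-distribʳ-+ (m + m) m m ⟨
      (m + m) * (m + m)
        ∎) (ℕ.<-irrefl refl)

-- A ring solver with integer coefficients over an arbitrary commutative ring.

module DifferenceSolver {c ℓ} (R : CommutativeRing c ℓ) where

  open CommutativeRing R hiding (zero)
  open import Algebra.Properties.AbelianGroup +-abelianGroup using (⁻¹-∙-comm; ⁻¹-anti-homo‿-)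
  open import Algebra.Properties.CommutativeSemigroup +-commutativeSemigroup using (interchange)
  open import Algebra.Properties.Group +-group using (x≈y⇒x∙y⁻¹≈ε; x∙y⁻¹≈ε⇒x≈y)
  open import Algebra.Properties.Ring ring using (-0#≈0#; x[y-z]≈xy-xz; [y-z]x≈yx-zx)
  open import Algebra.Properties.Semiring.Mult.TCOptimised semiring
    using (×-homo-+; ×1-homo-*) renaming (_×_ to _·_)
  open ≈-Reasoning setoid

  [x-y]+[z-w] : ∀ x y z w → (x - y) + (z - w) ≈ (x + z) - (y + w)
  [x-y]+[z-w] x y z w = trans (interchange x (- y) z (- w)) (+-congˡ (⁻¹-∙-comm y w))

  [x-y]-[z-w] : ∀ x y z w → (x - y) - (z - w) ≈ (x + w) - (y + z)
  [x-y]-[z-w] x y z w = trans (+-congˡ (⁻¹-anti-homo‿- z w)) ([x-y]+[z-w] x y w z)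

  [x-y][z-w] : ∀ x y z w → (x - y) * (z - w) ≈ (x * z + y * w) - (x * w + y * z)
  [x-y][z-w] x y z w = begin
    (x - y) * (z - w)                    ≈⟨ [y-z]x≈yx-zx (z - w) x y ⟩
    x * (z - w) - y * (z - w)            ≈⟨ +-cong (x[y-z]≈xy-xz x z w) (-‿cong (x[y-z]≈xy-xz y z w)) ⟩
    (x * z - x * w) - (y * z - y * w)    ≈⟨ [x-y]-[z-w] (x * z) (x * w) (y * z) (y * w) ⟩
    (x * z + y * w) - (x * w + y * z)    ∎

  -- The pair (m , n) stands for the integer m − n.
  differences : RawRing _ _
  differences = record
    { Carrier = ℕ × ℕ
    ; _≈_     = _≡_
    ; _+_     = λ { (a , b) (c , d) → a ℕ.+ c , b ℕ.+ d }
    ; _*_     = λ { (a , b) (c , d) → a ℕ.* c ℕ.+ b ℕ.* d , a ℕ.* d ℕ.+ b ℕ.* c }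
    ; -_      = swap
    ; 0#      = 0 , 0
    ; 1#      = 1 , 0
    }

  ι : ℕ → Carrier
  ι n = n · 1#

  ι-bilinear : ∀ a b c d → ι (a ℕ.* c ℕ.+ b ℕ.* d) ≈ ι a * ι c + ι b * ι d
  ι-bilinear a b c d =
    trans (×-homo-+ 1# (a ℕ.* c) (b ℕ.* d)) (+-cong (×1-homo-* a c) (×1-homo-* b d))

  -- The case split makes the coefficients 0 and 1 evaluate definitionally to 0# and 1#.
  eval : ℕ × ℕ → Carrier
  eval (m , zero)  = ι m
  eval (m , suc n) = ι m - ι (suc n)

  eval-≈ : ∀ m n → eval (m , n) ≈ ι m - ι n
  eval-≈ m zero    = sym (trans (+-congˡ -0#≈0#) (+-identityʳ (ι m)))
  eval-≈ m (suc n) = refl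

  differences⟶R : differences -Raw-AlmostCommutative⟶ fromCommutativeRing R
  differences⟶R = record
    { ⟦_⟧    = eval
    ; +-homo = λ { (a , b) (c , d) → begin
        eval (a ℕ.+ c , b ℕ.+ d)     ≈⟨ eval-≈ (a ℕ.+ c) (b ℕ.+ d) ⟩
        ι (a ℕ.+ c) - ι (b ℕ.+ d)    ≈⟨ +-cong (×-homo-+ 1# a c) (-‿cong (×-homo-+ 1# b d)) ⟩
        (ι a + ι c) - (ι b + ι d)    ≈⟨ [x-y]+[z-w] (ι a) (ι b) (ι c) (ι d) ⟨
        (ι a - ι b) + (ι c - ι d)    ≈⟨ +-cong (eval-≈ a b) (eval-≈ c d) ⟨
        eval (a , b) + eval (c , d)  ∎ }
    ; *-homo = λ { (a , b) (c , d) → begin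
        eval (a ℕ.* c ℕ.+ b ℕ.* d , a ℕ.* d ℕ.+ b ℕ.* c)
          ≈⟨ eval-≈ (a ℕ.* c ℕ.+ b ℕ.* d) (a ℕ.* d ℕ.+ b ℕ.* c) ⟩
        ι (a ℕ.* c ℕ.+ b ℕ.* d) - ι (a ℕ.* d ℕ.+ b ℕ.* c)
          ≈⟨ +-cong (ι-bilinear a b c d) (-‿cong (ι-bilinear a b d c)) ⟩
        (ι a * ι c + ι b * ι d) - (ι a * ι d + ι b * ι c)
          ≈⟨ [x-y][z-w] (ι a) (ι b) (ι c) (ι d) ⟨
        (ι a - ι b) * (ι c - ι d)
          ≈⟨ *-cong (eval-≈ a b) (eval-≈ c d) ⟨
        eval (a , b) * eval (c , d)
          ∎ }
    ; -‿homo = λ { (a , b) → begin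
        eval (b , a)    ≈⟨ eval-≈ b a ⟩
        ι b - ι a       ≈⟨ ⁻¹-anti-homo‿- (ι a) (ι b) ⟨
        - (ι a - ι b)   ≈⟨ -‿cong (eval-≈ a b) ⟨
        - eval (a , b)  ∎ }
    ; 0-homo = refl
    ; 1-homo = refl
    }

  eval-cong : ∀ a b c d → a ℕ.+ d ≡ b ℕ.+ c → eval (a , b) ≈ eval (c , d)
  eval-cong a b c d a+d≡b+c = begin
    eval (a , b)  ≈⟨ eval-≈ a b ⟩
    ι a - ι b     ≈⟨ x∙y⁻¹≈ε⇒x≈y (ι a - ι b) (ι c - ι d) difference≈0 ⟩
    ι c - ι d     ≈⟨ eval-≈ c d ⟨
    eval (c , d)  ∎
    where
    difference≈0 : (ι a - ι b) - (ι c - ι d) ≈ 0#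
    difference≈0 = begin
      (ι a - ι b) - (ι c - ι d)  ≈⟨ [x-y]-[z-w] (ι a) (ι b) (ι c) (ι d) ⟩
      (ι a + ι d) - (ι b + ι c)  ≈⟨ +-cong (×-homo-+ 1# a d) (-‿cong (×-homo-+ 1# b c)) ⟨
      ι (a ℕ.+ d) - ι (b ℕ.+ c)  ≈⟨ x≈y⇒x∙y⁻¹≈ε (reflexive (≡.cong ι a+d≡b+c)) ⟩
      0#                         ∎

  -- Coefficients are compared as integers, not as pairs: cancellation produces pairs such as (1 ,
  -- 1), which must be recognised as zero.
  _≟ᵈ_ : WeaklyDecidable (Induced-equivalence differences⟶R)
  (a , b) ≟ᵈ (c , d) = map (eval-cong a b c d) (dec⇒maybe (a ℕ.+ d ℕ.≟ b ℕ.+ c))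

  open Algebra.Solver.Ring differences (fromCommutativeRing R) differences⟶R _≟ᵈ_ public

-- Polynomial identities for lines, slopes and the volume.

module RingIdentities {c ℓ} (R : CommutativeRing c ℓ) where

  open CommutativeRing R
  open DifferenceSolver R using (solve; _:=_; _:*_; _:+_; _:-_)

  -- Subtracting the gaps between the two lines at `x` and at `y` cancels the intercepts `p` and
  -- `r`.
  subtract-lines : ∀ x y p r u v →
    (u - v) * (x - y) ≈ ((p + x * u) - (r + x * v)) - ((p + y * u) - (r + y * v))
  subtract-lines = solve 6 (λ x y p r u v → (u :- v) :* (x :- y) :=
    ((p :+ x :* u) :- (r :+ x :* v)) :- ((p :+ y :* u) :- (r :+ y :* v))) refl

  rise-over-run : ∀ x k₁ k₂ l₁ l₂ →
    l₁ - k₁ ≈ x * (k₂ - l₂) - ((k₁ + x * k₂) - (l₁ + x * l₂))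
  rise-over-run = solve 5 (λ x k₁ k₂ l₁ l₂ → l₁ :- k₁ :=
    x :* (k₂ :- l₂) :- ((k₁ :+ x :* k₂) :- (l₁ :+ x :* l₂))) refl

  factor-volume : ∀ m d x g₁ h₁ g₂ h₂ →
    m * d * (d * (g₁ - h₁) - x * d * (h₂ - g₂)) ≈ m * d * d * ((g₁ + x * g₂) - (h₁ + x * h₂))
  factor-volume = solve 7 (λ m d x g₁ h₁ g₂ h₂ →
    m :* d :* (d :* (g₁ :- h₁) :- x :* d :* (h₂ :- g₂)) :=
    m :* d :* d :* ((g₁ :+ x :* g₂) :- (h₁ :+ x :* h₂))) refl

-- The determinant when rows agree in pairs in the first two columns.

module _ {c ℓ₁ ℓ₂} (F : HeytingField c ℓ₁ ℓ₂) where

  open HeytingField F using (heytingCommutativeRing)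
  open HeytingCommutativeRing heytingCommutativeRing using (commutativeRing)
  open CommutativeRing commutativeRing hiding (zero)
  open DifferenceSolver commutativeRing using (solve; _:=_; _:*_; _:+_; _:-_; :-_; con; Polynomial)

  -- signᵖ and detᵖ copy sign and det to solver polynomials; at a literal size their
  -- evaluation is sign and det definitionally.
  signᵖ : ∀ {k} → ℕ → Polynomial k
  signᵖ zero    = con (1 , 0)
  signᵖ (suc n) = :- signᵖ n

  detᵖ : ∀ {k n} → Vector (Vector (Polynomial k) n) n → Polynomial k
  detᵖ {n = zero}  M = con (1 , 0)
  detᵖ {n = suc n} M = foldr _:+_ (con (0 , 0)) λ j →
    signᵖ (toℕ j) :* (M zero j :* detᵖ (λ i → removeAt (M (suc i)) j))

  -- Subtracting the first row of each pair from the second clears its first two entries. Exchanging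
  -- the two middle rows, at the cost of a sign, makes the matrix block triangular with 2 × 2
  -- blocks.
  vol-paired : ∀ x y z p₀ p₁ s₀ s₁ u₀ u₁ v₀ v₁ →
    vol F (x ∷ y ∷ p₀ ∷ s₀ ∷ []) (x ∷ y ∷ p₁ ∷ s₁ ∷ [])
          (x ∷ z ∷ u₀ ∷ v₀ ∷ []) (x ∷ z ∷ u₁ ∷ v₁ ∷ [])
      ≈ x * (z - y) * ((s₁ - s₀) * (u₁ - u₀) - (p₁ - p₀) * (v₁ - v₀))
  vol-paired = solve 11 (λ x y z p₀ p₁ s₀ s₁ u₀ u₁ v₀ v₁ →
    detᵖ ((x ∷ y ∷ p₀ ∷ s₀ ∷ []) ∷ (x ∷ y ∷ p₁ ∷ s₁ ∷ []) ∷
          (x ∷ z ∷ u₀ ∷ v₀ ∷ []) ∷ (x ∷ z ∷ u₁ ∷ v₁ ∷ []) ∷ [])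
      := x :* (z :- y) :* ((s₁ :- s₀) :* (u₁ :- u₀) :- (p₁ :- p₀) :* (v₁ :- v₀))) refl

-- Finite fields: decidable equality, inverses and intersecting lines.

module FiniteField {c ℓ₁ ℓ₂} (F : HeytingField c ℓ₁ ℓ₂) {q : ℕ}
  (enum : HasCardinality (fieldSetoid F) q) where

  open HeytingField F using (heytingCommutativeRing; _#_; tight; #⇒invertible)
  open HeytingCommutativeRing heytingCommutativeRing using (commutativeRing)
  open CommutativeRing commutativeRing hiding (zero)
  open import Algebra.Apartness.Properties.HeytingCommutativeRing heytingCommutativeRing using (x-0≈x)
  open import Algebra.Properties.Group +-group using (x≈y⇒x∙y⁻¹≈ε; x∙y⁻¹≈ε⇒x≈y; ∙-cancelʳ)
  open import Algebra.Properties.AbelianGroup +-abelianGroup using (xyx⁻¹≈y)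
  open RingIdentities commutativeRing
  open Inverse enum using () renaming (to to element; from to index; from-cong to index-cong)
  open ≈-Reasoning setoid

  element-index : ∀ x → element (index x) ≈ x
  element-index = Inverse.strictlyInverseˡ enum

  index-element : ∀ i → index (element i) ≡ i
  index-element = Inverse.strictlyInverseʳ enum

  index-injective : ∀ {x y} → index x ≡ index y → x ≈ y
  index-injective {x} {y} p =
    trans (sym (element-index x)) (trans (reflexive (≡.cong element p)) (element-index y))

  element-injective : ∀ {i j} → element i ≈ element j → i ≡ j
  element-injective {i} {j} p =
    ≡.trans (≡.sym (index-element i)) (≡.trans (index-cong p) (index-element j))

  _≈?_ : Decidable _≈_
  x ≈? y = map′ index-injective index-cong (index x ≟ index y)

  -- The inverse is found by search. If the search fails, `x` cannot be apart from 0, since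
  -- apartness would make x - 0 invertible; tightness then gives x ≈ 0.
  inverse : ∀ {x} → ¬ x ≈ 0# → ∃ λ y → x * y ≈ 1#
  inverse {x} x≉0 with any? (λ i → (x * element i) ≈? 1#)
  ... | yes (i , p) = element i , p
  ... | no none     = contradiction (proj₁ (tight x 0#) ¬x#0) x≉0
    where
    ¬x#0 : ¬ x # 0#
    ¬x#0 x#0 with y , _ , p ← #⇒invertible x#0 =
      none (index y , trans (*-cong (sym (x-0≈x x)) (element-index y)) p)

  *-cancel-0 : ∀ {x y} → ¬ x ≈ 0# → x * y ≈ 0# → y ≈ 0#
  *-cancel-0 {x} {y} x≉0 xy≈0 with z , xz≈1 ← inverse x≉0 = begin
    y            ≈⟨ *-identityˡ y ⟨
    1# * y       ≈⟨ *-congʳ xz≈1 ⟨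
    x * z * y    ≈⟨ *-congʳ (*-comm x z) ⟩
    z * x * y    ≈⟨ *-assoc z x y ⟩
    z * (x * y)  ≈⟨ *-congˡ xy≈0 ⟩
    z * 0#       ≈⟨ zeroʳ z ⟩
    0#           ∎

  *-≉0 : ∀ {x y} → ¬ x ≈ 0# → ¬ y ≈ 0# → ¬ x * y ≈ 0#
  *-≉0 x≉0 y≉0 xy≈0 = y≉0 (*-cancel-0 x≉0 xy≈0)

  x≉y⇒x-y≉0 : ∀ {x y} → ¬ x ≈ y → ¬ x - y ≈ 0#
  x≉y⇒x-y≉0 {x} {y} x≉y x-y≈0 = x≉y (x∙y⁻¹≈ε⇒x≈y x y x-y≈0)

  -- As functions of the slope variable, the two sides are lines with different gradients `u` and
  -- `v`; without zero divisors they meet at most once.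
  lines-meet-once : ∀ {x y p r u v} → ¬ u ≈ v → p + x * u ≈ r + x * v → p + y * u ≈ r + y * v → x ≈ y
  lines-meet-once {x} {y} {p} {r} {u} {v} u≉v px≈ py≈ = x∙y⁻¹≈ε⇒x≈y x y (*-cancel-0 (x≉y⇒x-y≉0 u≉v) (begin
    (u - v) * (x - y)
      ≈⟨ subtract-lines x y p r u v ⟩
    ((p + x * u) - (r + x * v)) - ((p + y * u) - (r + y * v))
      ≈⟨ +-cong (x≈y⇒x∙y⁻¹≈ε px≈) (-‿cong (x≈y⇒x∙y⁻¹≈ε py≈)) ⟩
    0# - 0#
      ≈⟨ -‿inverseʳ 0# ⟩
    0# ∎))

  -- The values r + x s on pairs from a set with more than √q elements.

  module _ {a : ℕ} (α : Fin a → Carrier) (α-injective : ∀ {i j} → α i ≈ α j → i ≡ j)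
    (q<a² : q ℕ.< a ℕ.* a) where

    -- An index below `a * a` encodes a point of A × A; `α₁` and `α₂` below are its coordinates.
    π₁ π₂ : Fin (a ℕ.* a) → Fin a
    π₁ k = proj₁ (remQuot {a} a k)
    π₂ k = proj₂ (remQuot {a} a k)

    α₁ α₂ : Fin (a ℕ.* a) → Carrier
    α₁ k = α (π₁ k)
    α₂ k = α (π₂ k)

    pair-injective : ∀ {k l} → α₁ k ≈ α₁ l → α₂ k ≈ α₂ l → k ≡ l
    pair-injective {k} {l} p₁ p₂ = ≡.trans (≡.sym (combine-remQuot {a} a k)) (≡.trans
      (≡.cong₂ combine (α-injective p₁) (α-injective p₂)) (combine-remQuot {a} a l))

    φ : Carrier → Fin (a ℕ.* a) → Carrier
    φ x k = α₁ k + x * α₂ k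

    -- If the second coordinates agreed, cancelling their multiples by `x` would make the first ones
    -- agree too, so the points would coincide.
    α₂≉ : ∀ {x k l} → k ≢ l → φ x k ≈ φ x l → ¬ α₂ k ≈ α₂ l
    α₂≉ {x} {k} {l} k≢l φk≈φl α₂k≈α₂l = k≢l (pair-injective
      (∙-cancelʳ (x * α₂ l) (α₁ k) (α₁ l) (trans (+-congˡ (*-congˡ (sym α₂k≈α₂l))) φk≈φl)) α₂k≈α₂l)

    -- Pigeonhole: `a * a` points share only `q` values of `φ x`. By `rise`, a collision exhibits
    -- `x` as the quotient of `α₁ l - α₁ k` by `α₂ k - α₂ l`.
    slope-as-quotient : ∀ x → ∃₂ λ k l → ¬ α₂ k ≈ α₂ l × φ x k ≈ φ x l
    slope-as-quotient x with k , l , k<l , p ← pigeonhole q<a² (λ k → index (φ x k)) =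
      k , l , α₂≉ (<⇒≢ k<l) (index-injective p) , index-injective p

    lines-separated : ∀ {ξ η k l} → k ≢ l →
      index (φ (element ξ) k) ≡ index (φ (element ξ) l) →
      index (φ (element η) k) ≡ index (φ (element η) l) → ξ ≡ η
    lines-separated k≢l p r = element-injective
      (lines-meet-once (α₂≉ k≢l (index-injective p)) (index-injective p) (index-injective r))

    -- Adding `t` is injective on indices, so `meets-translates` gives a single `x`, chosen before
    -- `t`, for which the image of `φ x` meets all its translates.
    differences-cover : ∃ λ x → ∀ t → ∃₂ λ k l → φ x k ≈ φ x l + t
    differences-cover = element ξ , cover
      where
      translates = Counting.meets-translates (λ ξ k → index (φ (element ξ) k))
                     -- The index of 0 witnesses that `q` is not zero.
                     {{nonZeroIndex (index 0#)}} q<a² lines-separated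
      ξ = proj₁ translates

      cover : ∀ t → ∃₂ λ k l → φ (element ξ) k ≈ φ (element ξ) l + t
      cover t =
        let k , l , p = proj₂ translates (λ i → index (element i + t))
              (λ {i} {j} r → element-injective (∙-cancelʳ t (element i) (element j) (index-injective r)))
        in k , l , trans (index-injective p) (+-congʳ (element-index (φ (element ξ) l)))

    rise : ∀ {x k l} → φ x k ≈ φ x l → α₁ l - α₁ k ≈ x * (α₂ k - α₂ l)
    rise {x} {k} {l} φk≈φl = begin
      α₁ l - α₁ k
        ≈⟨ rise-over-run x (α₁ k) (α₂ k) (α₁ l) (α₂ l) ⟩
      x * (α₂ k - α₂ l) - (φ x k - φ x l)
        ≈⟨ +-congˡ (-‿cong (x≈y⇒x∙y⁻¹≈ε φk≈φl)) ⟩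
      x * (α₂ k - α₂ l) - 0#
        ≈⟨ x-0≈x (x * (α₂ k - α₂ l)) ⟩
      x * (α₂ k - α₂ l) ∎

    -- Supplies the constant first column of the matrix: two distinct elements cannot both vanish.
    nonzero-of-distinct : ∀ {i j} → ¬ α i ≈ α j → ∃ λ k → ¬ α k ≈ 0#
    nonzero-of-distinct {i} {j} αi≉αj with α i ≈? 0#
    ... | no αi≉0  = i , αi≉0
    ... | yes αi≈0 = j , λ αj≈0 → αi≉αj (trans αi≈0 (sym αj≈0))

    row : (i j r s : Fin a) → Vector Carrier 4
    row i j r s = α i ∷ α j ∷ α r ∷ α s ∷ []

    row-∈ : ∀ {p} (A : Pred Carrier p) → (∀ i → A (α i)) → ∀ i j r s → A×A×A×A F A (row i j r s)
    row-∈ A α∈A i j r s zero                   = α∈A i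
    row-∈ A α∈A i j r s (suc zero)             = α∈A j
    row-∈ A α∈A i j r s (suc (suc zero))       = α∈A r
    row-∈ A α∈A i j r s (suc (suc (suc zero))) = α∈A s

    -- The colliding points `k` and `l` fill the rows so that the second and fourth columns both
    -- contribute the difference d. The second coordinates of `g` and `h` enter in reverse order,
    -- which turns the minus sign of the determinant into the plus sign of r + x s.
    vol-rows : ∀ {x k l} m g h → φ x k ≈ φ x l →
      vol F (row m (π₂ l) (π₁ k) (π₂ l)) (row m (π₂ l) (π₁ l) (π₂ k))
            (row m (π₂ k) (π₁ h) (π₂ g)) (row m (π₂ k) (π₁ g) (π₂ h))
        ≈ α m * (α₂ k - α₂ l) * (α₂ k - α₂ l) * (φ x g - φ x h)
    vol-rows {x} {k} {l} m g h φk≈φl = begin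
      vol F (row m (π₂ l) (π₁ k) (π₂ l)) (row m (π₂ l) (π₁ l) (π₂ k))
            (row m (π₂ k) (π₁ h) (π₂ g)) (row m (π₂ k) (π₁ g) (π₂ h))
        ≈⟨ vol-paired F (α m) (α₂ l) (α₂ k) (α₁ k) (α₁ l) (α₂ l) (α₂ k) (α₁ h) (α₁ g) (α₂ g) (α₂ h) ⟩
      α m * d * (d * (α₁ g - α₁ h) - (α₁ l - α₁ k) * (α₂ h - α₂ g))
        ≈⟨ *-congˡ (+-congˡ (-‿cong (*-congʳ (rise φk≈φl)))) ⟩
      α m * d * (d * (α₁ g - α₁ h) - x * d * (α₂ h - α₂ g))
        ≈⟨ factor-volume (α m) d x (α₁ g) (α₁ h) (α₂ g) (α₂ h) ⟩
      α m * d * d * (φ x g - φ x h) ∎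
      where d = α₂ k - α₂ l

    volSet-full : ∀ {p} (A : Pred Carrier p) → (∀ i → A (α i)) → ∀ t → volSet F (A×A×A×A F A) t
    volSet-full A α∈A t =
      let x , cover               = differences-cover
          k , l , α₂k≉α₂l , φk≈φl = slope-as-quotient x
          m , αm≉0                = nonzero-of-distinct α₂k≉α₂l
          d≉0                     = x≉y⇒x-y≉0 α₂k≉α₂l
          c⁻¹ , cc⁻¹≈1            = inverse (*-≉0 (*-≉0 αm≉0 d≉0) d≉0)
          -- The volume will be `c` times the difference of the two values of `φ x`, so that
          -- difference is prescribed as `c⁻¹ * t`.
          g , h , φg≈φh+c⁻¹t      = cover (c⁻¹ * t)
          c                       = α m * (α₂ k - α₂ l) * (α₂ k - α₂ l)
      in row m (π₂ l) (π₁ k) (π₂ l) , row m (π₂ l) (π₁ l) (π₂ k)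
       , row m (π₂ k) (π₁ h) (π₂ g) , row m (π₂ k) (π₁ g) (π₂ h)
       , row-∈ A α∈A m (π₂ l) (π₁ k) (π₂ l) , row-∈ A α∈A m (π₂ l) (π₁ l) (π₂ k)
       , row-∈ A α∈A m (π₂ k) (π₁ h) (π₂ g) , row-∈ A α∈A m (π₂ k) (π₁ g) (π₂ h)
       , sym (begin
           vol F (row m (π₂ l) (π₁ k) (π₂ l)) (row m (π₂ l) (π₁ l) (π₂ k))
                 (row m (π₂ k) (π₁ h) (π₂ g)) (row m (π₂ k) (π₁ g) (π₂ h))
             ≈⟨ vol-rows m g h φk≈φl ⟩
           c * (φ x g - φ x h)
             ≈⟨ *-congˡ (trans (+-congʳ φg≈φh+c⁻¹t) (xyx⁻¹≈y (φ x h) (c⁻¹ * t))) ⟩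
           c * (c⁻¹ * t)
             ≈⟨ *-assoc c c⁻¹ t ⟨
           c * c⁻¹ * t
             ≈⟨ trans (*-congʳ cc⁻¹≈1) (*-identityˡ t) ⟩
           t ∎)

-- From an enumeration of `A` to an injective family of field elements.

open import Data.Nat.Base using (_<_; _*_)

theorem2p8 : ∀ {c ℓ₁ ℓ₂ p} (F : HeytingField c ℓ₁ ℓ₂) (q : ℕ) →
    HasCardinality (fieldSetoid F) q →
    (A : Pred (HeytingField.Carrier F) p) →
    A Respects (HeytingField._≈_ F) →
    (a : ℕ) → HasCardinality (SubSetoid (fieldSetoid F) A) a →
    q < a * a →
    volSet F (A×A×A×A F A) ≐ U
theorem2p8 F q enum A _ a enumA q<a² = (λ _ → tt) , λ {t} _ →
  volSet-full (λ i → proj₁ (to i)) to-injective q<a² A (λ i → proj₂ (to i)) t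
  where
  open FiniteField F enum using (volSet-full)
  open Inverse enumA using (to; from-cong; strictlyInverseʳ)

  -- `SubSetoid` compares first components only, so `from-cong` accepts an equality of the
  -- underlying field elements.
  to-injective : ∀ {i j} → HeytingField._≈_ F (proj₁ (to i)) (proj₁ (to j)) → i ≡ j
  to-injective {i} {j} p =
    ≡.trans (≡.sym (strictlyInverseʳ i)) (≡.trans (from-cong p) (strictlyInverseʳ j))
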